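{- Let $c$ be a positive integer and let $G$ be a triangle-free $4$-sunspot-free graph with $\chi(G)>2c+1$. Then $G$ has an induced subgraph $L$ with $\chi(L)=c+1$ that is non-degenerate, liberal, and flapless.
   Context: Graphs are finite and simple. A $4$-sunspot in $G$ is a $7$-tuple $(x_1,x_2,x_3,x_4;y_1,y_2,y_3)$ of pairwise distinct vertices such that the edges of $G$ among these seven vertices are exactly $x_1x_2,x_2x_3,x_3x_4,x_4x_1,x_1y_1,x_2y_2,x_3y_3$; $G$ is $4$-sunspot-free if there is no $4$-sunspot in $G$. A hole in $G$ is an induced subgraph that is a cycle on at least four vertices; its length is its number of edges. For a hole $H$, an $H$-flap is a hole of length $4$ in $G$ sharing at least one edge with $H$. A graph $G$ is non-degenerate if every vertex has degree at least $\chi(G)-1$; liberal if for all distinct non-adjacent vertices $x,y$, both $N(x)\setminus N(y)$ and $N(y)\setminus N(x)$ are nonempty; flapless if for every hole $H$ of length at least $6$ in $G$ there is no $H$-flap in $G$. -}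

module Defs where

open import Data.Nat using (ℕ; zero; suc; _+_; _*_; _∸_; _≤_; _<_)
open import Data.Fin using (Fin; toℕ) renaming (zero to f0; suc to fs)
open import Data.Bool using (Bool; true; false)
open import Data.List using (length; filterᵇ; allFin)
open import Data.Product using (Σ; ∃; ∃-syntax; _×_; _,_)
open import Data.Sum using (_⊎_)
open import Relation.Nullary using (¬_)
open import Data.Empty using (⊥)
open import Relation.Binary.PropositionalEquality using (_≡_; _≢_; refl)
open import Function.Definitions using (Injective)

record Graph : Set where
  field
    n      : ℕ
    adj    : Fin n → Fin n → Bool
    sym    : ∀ u v → adj u v ≡ adj v u
    irrefl : ∀ v → adj v v ≡ false
open Graph public

V : Graph → Set
V G = Fin (n G)

E : (G : Graph) → V G → V G → Set
E G u v = adj G u v ≡ true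

-- Induced subgraph of G on the image of an (injective) map ι : Fin m → V G.
induced : (G : Graph) (m : ℕ) → (Fin m → V G) → Graph
induced G m ι = record
  { n = m
  ; adj = λ i j → adj G (ι i) (ι j)
  ; sym = λ i j → Graph.sym G (ι i) (ι j)
  ; irrefl = λ i → Graph.irrefl G (ι i) }

Colorable : Graph → ℕ → Set
Colorable G k = Σ (V G → Fin k) λ f → ∀ u v → E G u v → f u ≢ f v

ChromaticNumber : Graph → ℕ → Set
ChromaticNumber G k = Colorable G k × (∀ j → j < k → ¬ Colorable G j)

ChromaticNumberGreaterThan : Graph → ℕ → Set
ChromaticNumberGreaterThan G k = ∀ j → Colorable G j → k < j

degree : (G : Graph) → V G → ℕ
degree G v = length (filterᵇ (adj G v) (allFin (n G)))

TriangleFree : Graph → Set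
TriangleFree G = ∀ u v w → E G u v → E G v w → E G u w → ⊥

-- Adjacency pattern of a 4-sunspot on indices 0..6 = (x1,x2,x3,x4;y1,y2,y3):
-- edges x1x2, x2x3, x3x4, x4x1, x1y1, x2y2, x3y3.
sunEdge : Fin 7 → Fin 7 → Bool
sunEdge i j = pat (toℕ i) (toℕ j)
  where
  pat0 : ℕ → ℕ → Bool
  pat0 0 1 = true
  pat0 1 2 = true
  pat0 2 3 = true
  pat0 3 0 = true
  pat0 0 4 = true
  pat0 1 5 = true
  pat0 2 6 = true
  pat0 _ _ = false
  pat : ℕ → ℕ → Bool
  pat a b with pat0 a b
  ... | true = true
  ... | false = pat0 b a

Sunspot4 : (G : Graph) → (Fin 7 → V G) → Set
Sunspot4 G s = Injective _≡_ _≡_ s × (∀ i j → adj G (s i) (s j) ≡ sunEdge i j)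

SunspotFree4 : Graph → Set
SunspotFree4 G = ∀ s → ¬ Sunspot4 G s

CycSucc : (k : ℕ) → Fin k → Fin k → Set
CycSucc k i j = (toℕ j ≡ suc (toℕ i)) ⊎ (suc (toℕ i) ≡ k × toℕ j ≡ 0)

CycAdj : (k : ℕ) → Fin k → Fin k → Set
CycAdj k i j = CycSucc k i j ⊎ CycSucc k j i

Hole : (G : Graph) (k : ℕ) → (Fin k → V G) → Set
Hole G k h = 4 ≤ k × Injective _≡_ _≡_ h
           × (∀ i j → (E G (h i) (h j) → CycAdj k i j) × (CycAdj k i j → E G (h i) (h j)))

ShareEdge : (G : Graph) (k l : ℕ) → (Fin k → V G) → (Fin l → V G) → Set
ShareEdge G k l h f = ∃[ i ] ∃[ j ] ∃[ a ] ∃[ b ]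
  (CycAdj k i j × CycAdj l a b × h i ≡ f a × h j ≡ f b)

Flap : (G : Graph) (k : ℕ) → (Fin k → V G) → (Fin 4 → V G) → Set
Flap G k h f = Hole G 4 f × ShareEdge G k 4 h f

Flapless : Graph → Set
Flapless G = ∀ k (h : Fin k → V G) → Hole G k h → 6 ≤ k → ∀ f → ¬ Flap G k h f

NonDegenerate : Graph → Set
NonDegenerate G = ∀ χ → ChromaticNumber G χ → ∀ v → χ ∸ 1 ≤ degree G v

Liberal : Graph → Set
Liberal G = ∀ x y → x ≢ y → ¬ E G x y →
  (∃[ z ] (E G x z × ¬ E G y z)) × (∃[ z ] (E G y z × ¬ E G x z))

{-# OPTIONS --safe #-}
module Submission where

-- Choose a set R of roots greedily so that every vertex is within distance 3 of R and there is no
-- walk of length 3 between distinct roots. As there are no triangles, R and its neighbourhood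
-- N(R) ∖ R are stable and the next two distance layers are all that remains, so one of these is
-- not c-colourable; take an induced subgraph L of it that is critical for this. Criticality makes
-- L non-degenerate and liberal. Every vertex of L has a parent p one layer down, and p has a neighbour q with no
-- neighbour in L. Given a hole of length at least 6 in L with a flap, such a p and q supply the
-- pendant edges of a 4-sunspot.

open import Defs hiding (sym)
open import Data.Bool using (T; true; false)
import Data.Bool.Properties as Bool
open import Data.Empty using (⊥; ⊥-elim)
open import Data.Fin using (Fin; zero; suc; toℕ; fromℕ; fromℕ<; inject₁; inject≤; splitAt; punchIn; punchOut; _↑ˡ_; _↑ʳ_; finToFun; funToFin)
import Data.Fin.Properties as Fin
open import Data.List as List using (List; []; _∷_; length; map; filter; filterᵇ; allFin)
open import Data.List.Membership.DecPropositional using (_∈?_)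
open import Data.List.Membership.Propositional using (_∈_)
open import Data.List.Membership.Propositional.Properties using (∈-map⁺; ∈-filter⁺; ∈-filter⁻; ∈-allFin; ∈-lookup)
import Data.List.Properties as List
import Data.List.Relation.Unary.All as All
open import Data.List.Relation.Unary.AllPairs using (_∷_)
open import Data.List.Relation.Unary.Any using (here; there; index)
open import Data.List.Relation.Unary.Any.Properties using (lookup-index)
open import Data.List.Relation.Unary.Unique.Propositional using (Unique)
import Data.List.Relation.Unary.Unique.Propositional.Properties as Unique
open import Data.Nat using (ℕ; zero; suc; _+_; _*_; _≤_; _<_; s≤s; z≤n)
open import Data.Nat.GeneralisedArithmetic using (fold; fold-+)
import Data.Nat.Properties as ℕ
open import Data.Product using (Σ; ∃-syntax; _×_; _,_; proj₁; proj₂)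
open import Data.Sum using (_⊎_; inj₁; inj₂; fromInj₂; swap)
open import Data.Unit using (⊤; tt)
open import Data.Vec using (lookup; []; _∷_)
open import Data.Vec.Functional using (insertAt)
open import Data.Vec.Functional.Properties using (insertAt-lookup; insertAt-punchIn)
open import Function using (_∘_; id)
open import Function.Definitions using (Injective)
open import Level using (0ℓ)
open import Relation.Nullary using (¬_; Dec; yes; no; contradiction)
open import Relation.Nullary.Decidable using (toWitness; decidable-stable; map′; T?; ¬?; _→-dec_; _×-dec_; _⊎-dec_)
open import Relation.Unary using (Pred; Decidable; _∪_)
open import Relation.Binary.PropositionalEquality using (_≡_; _≢_; refl; sym; trans; cong; subst; subst₂)

-- Symmetric adjacency patterns and the 4-sunspot pattern.

UpperTriangle : (n : ℕ) → (Fin n → Fin n → Set) → Set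
UpperTriangle zero    P = ⊤
UpperTriangle (suc n) P = (∀ j → P zero (suc j)) × UpperTriangle n λ i j → P (suc i) (suc j)

-- Cuts the 49 adjacency checks on seven vertices down to the 21 pairs above the diagonal.
fill-symmetric : ∀ n {P : Fin n → Fin n → Set} → (∀ {i j} → P i j → P j i) → (∀ i → P i i) →
                 UpperTriangle n P → ∀ i j → P i j
fill-symmetric (suc n) s r (row , rows) zero    zero    = r zero
fill-symmetric (suc n) s r (row , rows) zero    (suc j) = row j
fill-symmetric (suc n) s r (row , rows) (suc i) zero    = s (row i)
fill-symmetric (suc n) s r (row , rows) (suc i) (suc j) = fill-symmetric n s (r ∘ suc) rows i j

sunEdge-sym : ∀ i j → sunEdge i j ≡ sunEdge j i
sunEdge-sym = toWitness {a? = Fin.all? λ i → Fin.all? λ j → sunEdge i j Bool.≟ sunEdge j i} tt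

sunEdge-irrefl : ∀ i → sunEdge i i ≡ false
sunEdge-irrefl = toWitness {a? = Fin.all? λ i → sunEdge i i Bool.≟ false} tt

-- Makes injectivity of a 4-sunspot automatic: equal vertices would have equal adjacency rows.
sunEdge-rows-distinct : ∀ i j → (∀ k → sunEdge i k ≡ sunEdge j k) → i ≡ j
sunEdge-rows-distinct = toWitness
  {a? = Fin.all? λ i → Fin.all? λ j → Fin.all? (λ k → sunEdge i k Bool.≟ sunEdge j k) →-dec i Fin.≟ j} tt

E? : ∀ G u v → Dec (E G u v)
E? G u v = adj G u v Bool.≟ true

E-sym : ∀ G {u v} → E G u v → E G v u
E-sym G {u} {v} = trans (Graph.sym G v u)

infixr 5 _◂_
_◂_ : ∀ {n} {P : Fin (suc n) → Set} → P zero → (∀ i → P (suc i)) → ∀ i → P i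
_◂_ = Fin.∀-cons

-- 4-sunspots around a hole with a flap.

module _ (G : Graph) (triangle-free : TriangleFree G) (sunspot-free : SunspotFree4 G) where

  infix 4 _~_ _≁_
  _~_ _≁_ : V G → V G → Set
  u ~ v = E G u v
  u ≁ v = ¬ u ~ v

  ~-sym : ∀ {u v} → u ~ v → v ~ u
  ~-sym = E-sym G

  ≁-sym : ∀ {u v} → u ≁ v → v ≁ u
  ≁-sym u≁v = u≁v ∘ ~-sym

  no-triangle : ∀ {u v w} → u ~ v → v ~ w → u ≁ w
  no-triangle = triangle-free _ _ _

  -- The remaining non-edges of a 4-sunspot hold since there is no triangle.
  no-sunspot : ∀ {x₁ x₂ x₃ x₄ y₁ y₂ y₃} →
    x₁ ~ x₂ → x₂ ~ x₃ → x₃ ~ x₄ → x₄ ~ x₁ → x₁ ~ y₁ → x₂ ~ y₂ → x₃ ~ y₃ →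
    y₁ ≁ x₃ → y₂ ≁ x₄ → y₃ ≁ x₁ → y₁ ≁ y₂ → y₂ ≁ y₃ → y₁ ≁ y₃ → ⊥
  no-sunspot {x₁} {x₂} {x₃} {x₄} {y₁} {y₂} {y₃}
    e₁₂ e₂₃ e₃₄ e₄₁ f₁ f₂ f₃ g₁₃ g₂₄ g₃₁ g₁₂ g₂₃ g₁₃′ = sunspot-free s (s-injective , pattern-s)
    where
    s : Fin 7 → V G
    s = lookup (x₁ ∷ x₂ ∷ x₃ ∷ x₄ ∷ y₁ ∷ y₂ ∷ y₃ ∷ [])

    non : ∀ {u v} → u ≁ v → adj G u v ≡ false
    non = Bool.¬-not

    pattern-s : ∀ i j → adj G (s i) (s j) ≡ sunEdge i j
    pattern-s = fill-symmetric 7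
      (λ {i} {j} p → trans (Graph.sym G (s j) (s i)) (trans p (sunEdge-sym i j)))
      (λ i → trans (Graph.irrefl G (s i)) (sym (sunEdge-irrefl i)))
      ( (e₁₂ ◂ non (no-triangle e₁₂ e₂₃) ◂ ~-sym e₄₁ ◂ f₁ ◂ non (no-triangle e₁₂ f₂) ◂ non (≁-sym g₃₁) ◂ λ ())
      , (e₂₃ ◂ non (no-triangle e₂₃ e₃₄) ◂ non (no-triangle (~-sym e₁₂) f₁) ◂ f₂ ◂ non (no-triangle e₂₃ f₃) ◂ λ ())
      , (e₃₄ ◂ non (≁-sym g₁₃) ◂ non (no-triangle (~-sym e₂₃) f₂) ◂ f₃ ◂ λ ())
      , (non (no-triangle e₄₁ f₁) ◂ non (≁-sym g₂₄) ◂ non (no-triangle (~-sym e₃₄) f₃) ◂ λ ())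
      , (non g₁₂ ◂ non g₁₃′ ◂ λ ())
      , (non g₂₃ ◂ λ ())
      , (λ ()) , tt )

    s-injective : Injective _≡_ _≡_ s
    s-injective {i} {j} si≡sj = sunEdge-rows-distinct i j λ k →
      trans (sym (pattern-s i k)) (trans (cong (λ v → adj G v (s k)) si≡sj) (pattern-s j k))

  module _ (InL : V G → Set)
    (private-neighbour : ∀ {x y} → InL x → InL y → x ≢ y → x ≁ y → ∃[ z ] (InL z × x ~ z × y ≁ z))
    where

    -- `q` is a ready-made pendant neighbour of `p` in a 4-sunspot, as it misses every vertex of
    -- `InL`.
    Anchored : V G → Set
    Anchored p = ∃[ q ] (p ~ q × (∀ {z} → InL z → q ≁ z))

    -- The hole is unrolled into an infinite walk, which avoids arithmetic modulo its length. The
    -- non-edges at two, three and four steps are those that length at least 6 guarantees.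
    module _ (parent : ∀ {x} → InL x → ∃[ p ] (x ~ p × Anchored p))
      (w : ℕ → V G) (inL : ∀ t → InL (w t)) (step : ∀ t → w t ~ w (1 + t))
      (gap₂ : ∀ t → w t ≁ w (2 + t)) (gap₃ : ∀ t → w t ≁ w (3 + t)) (gap₄ : ∀ t → w t ≁ w (4 + t))
      where

      step⁻ : ∀ t → w (1 + t) ~ w t
      step⁻ t = ~-sym (step t)

      -- Otherwise `w (1 + t)`, `p`, `w (3 + t)`, `w (2 + t)` is a 4-cycle whose first three
      -- vertices have pendants `w t`, `q`, `w (4 + t)`.
      anchored-no-skip : ∀ t {p} → Anchored p → p ~ w (1 + t) → p ≁ w (3 + t)
      anchored-no-skip t {p} (q , p~q , q≁L) p~1 p~3 =
        no-sunspot (~-sym p~1) p~3 (step⁻ (2 + t)) (step⁻ (1 + t))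
          (step⁻ t) p~q (step (3 + t))
          (gap₃ t) (q≁L (inL _)) (≁-sym (gap₃ (1 + t)))
          (≁-sym (q≁L (inL _))) (q≁L (inL _)) (gap₄ t)

      -- If `a` differs from `w (3 + t)`, they are opposite corners of a 4-cycle. Their private
      -- neighbours `y`, `z` and a parent `p` of `w (3 + t)` serve as pendants; each 4-sunspot
      -- avoided forces one more edge.
      no-skip : ∀ t {a} → InL a → a ~ w (2 + t) → a ~ w (4 + t) → a ≡ w (3 + t)
      no-skip t {a} a∈L a~2 a~4 = decidable-stable (a Fin.≟ _) λ a≢3 →
        let
          -- In local names a numeral `i` stands for `w (i + t)`.
          a≁3 = no-triangle a~2 (step (2 + t))
          (z , z∈L , 3~z , a≁z) = private-neighbour (inL (3 + t)) a∈L (a≢3 ∘ sym) (≁-sym a≁3)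
          (y , y∈L , a~y , 3≁y) = private-neighbour a∈L (inL (3 + t)) a≢3 a≁3
          (p , 3~p , p-anchored@(q , p~q , q≁L)) = parent (inL (3 + t))
          p≁1 = λ p~1 → anchored-no-skip t p-anchored p~1 (~-sym 3~p)
          p≁5 = anchored-no-skip (2 + t) p-anchored (~-sym 3~p)
          a≁1 = no-triangle a~2 (step⁻ (1 + t))
          a≁5 = no-triangle a~4 (step (4 + t))
          p~a = decidable-stable (E? G p a) λ p≁a →
            no-sunspot (step (2 + t)) (step (3 + t)) (~-sym a~4) a~2
              (step⁻ (1 + t)) 3~p (step (4 + t))
              (gap₃ (1 + t)) p≁a (≁-sym (gap₃ (2 + t)))
              (≁-sym p≁1) p≁5 (gap₄ (1 + t))
          z~1 = decidable-stable (E? G z (w (1 + t))) λ z≁1 →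
            no-sunspot (~-sym 3~p) (step⁻ (2 + t)) (~-sym a~2) (~-sym p~a)
              p~q 3~z (step⁻ (1 + t))
              (q≁L (inL _)) (≁-sym a≁z) (≁-sym p≁1)
              (q≁L z∈L) z≁1 (q≁L (inL _))
          y~1 = decidable-stable (E? G y (w (1 + t))) λ y≁1 →
            no-sunspot p~a a~2 (step (2 + t)) 3~p
              p~q a~y (step⁻ (1 + t))
              (q≁L (inL _)) (≁-sym 3≁y) (≁-sym p≁1)
              (q≁L y∈L) y≁1 (q≁L (inL _))
        -- `z` and `y` share the neighbour `w (1 + t)`, so they are non-adjacent and can be pendants
        -- together.
        in no-sunspot 3~p p~a a~2 (step (2 + t))
             3~z p~q a~y
             (≁-sym a≁z) (q≁L (inL _)) (≁-sym 3≁y)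
             (≁-sym (q≁L z∈L)) (q≁L y∈L) (no-triangle z~1 (~-sym y~1))

      -- A parent `p` of `a` is forced to meet both `w 6` and a parent `t` of `w 5`; then `p`,
      -- `w 6`, `w 5`, `t` is a 4-cycle with pendants `q`, `w 7`, `w 4`. Positions 4 and 5 leave
      -- room behind the edge for `no-skip 0`.
      no-flap : ∀ {a b} → InL a → InL b → w 4 ~ a → a ~ b → b ~ w 5 → a ≢ w 5 → b ≢ w 4 → ⊥
      no-flap {a} {b} a∈L b∈L 4~a a~b b~5 a≢5 b≢4 =
        let
          a~4 = ~-sym 4~a
          a≁6 = a≢5 ∘ no-skip 2 a∈L a~4
          b≁3 = λ b~3 → b≢4 (no-skip 1 b∈L b~3 b~5)
          a≢3 = λ a≡3 → b≁3 (subst (b ~_) a≡3 (~-sym a~b))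
          a≁2 = λ a~2 → a≢3 (no-skip 0 a∈L a~2 a~4)
          a≁3 = no-triangle a~4 (step⁻ 3)
          a≁5 = no-triangle a~4 (step 4)
          (p , a~p , p-anchored@(q , p~q , q≁L)) = parent a∈L
          p~a = ~-sym a~p
          p≁4 = no-triangle p~a a~4
          p≁5 = λ p~5 →
            no-sunspot p~5 (step⁻ 4) 4~a a~p
              p~q (step 5) (step⁻ 3)
              (q≁L (inL _)) (≁-sym a≁6) (λ 3~p → anchored-no-skip 2 p-anchored (~-sym 3~p) p~5)
              (q≁L (inL _)) (≁-sym (gap₃ 3)) (q≁L (inL _))
          p≁3 = λ p~3 →
            no-sunspot p~3 (step 3) 4~a a~p
              p~q (step⁻ 2) (step 4)
              (q≁L (inL _)) (≁-sym a≁2) (≁-sym p≁5)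
              (q≁L (inL _)) (gap₃ 2) (q≁L (inL _))
          -- The flap with pendants `p`, `w 3`, `w 6` is a 4-sunspot unless `p` meets `w 6`.
          -- Replacing `w 6` by `t` gives `p~t` below.
          p~6 = decidable-stable (E? G p (w 6)) λ p≁6 →
            no-sunspot a~4 (step 4) (~-sym b~5) (~-sym a~b)
              a~p (step⁻ 3) (step 5)
              p≁5 (≁-sym b≁3) (≁-sym a≁6)
              p≁3 (gap₃ 3) p≁6
          (t , 5~t , t-anchored) = parent (inL 5)
          t~5 = ~-sym 5~t
          t≁3 = λ t~3 → anchored-no-skip 2 t-anchored t~3 t~5
          t≁7 = anchored-no-skip 4 t-anchored t~5
          t≁4 = no-triangle t~5 (step⁻ 4)
          t≁a = λ t~a →
            no-sunspot t~5 (step⁻ 4) 4~a (~-sym t~a)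
              (proj₁ (proj₂ t-anchored)) (step 5) (step⁻ 3)
              (proj₂ (proj₂ t-anchored) (inL _)) (≁-sym a≁6) (≁-sym t≁3)
              (proj₂ (proj₂ t-anchored) (inL _)) (≁-sym (gap₃ 3)) (proj₂ (proj₂ t-anchored) (inL _))
          p~t = decidable-stable (E? G p t) λ p≁t →
            no-sunspot a~4 (step 4) (~-sym b~5) (~-sym a~b)
              a~p (step⁻ 3) 5~t
              p≁5 (≁-sym b≁3) t≁a
              p≁3 (≁-sym t≁3) p≁t
        in no-sunspot p~6 (step⁻ 5) 5~t (~-sym p~t)
             p~q (step 6) (step⁻ 4)
             (q≁L (inL _)) (≁-sym t≁7) (≁-sym p≁4)
             (q≁L (inL _)) (≁-sym (gap₃ 4)) (q≁L (inL _))

-- Predecessors along a cycle.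

cycPred : ∀ {k} → Fin (suc k) → Fin (suc k)
cycPred zero    = fromℕ _
cycPred (suc i) = inject₁ i

cycPred-succ : ∀ {k} (i : Fin (suc k)) → CycSucc (suc k) (cycPred i) i
cycPred-succ zero    = inj₂ (cong suc (Fin.toℕ-fromℕ _) , refl)
cycPred-succ (suc i) = inj₁ (cong suc (sym (Fin.toℕ-inject₁ i)))

cycPred-unique : ∀ {k} {i j : Fin (suc k)} → CycSucc (suc k) j i → j ≡ cycPred i
cycPred-unique {i = zero}  (inj₂ (1+j≡1+k , _)) =
  Fin.toℕ-injective (trans (ℕ.suc-injective 1+j≡1+k) (sym (Fin.toℕ-fromℕ _)))
cycPred-unique {i = suc i} (inj₁ 1+i≡1+j) =
  Fin.toℕ-injective (trans (sym (ℕ.suc-injective 1+i≡1+j)) (sym (Fin.toℕ-inject₁ i)))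

cycPred^ : ∀ {k} → ℕ → Fin (suc k) → Fin (suc k)
cycPred^ e i = fold i cycPred e

-- At most `suc k` steps wrap past zero at most once, hence the two alternatives.
toℕ-cycPred^ : ∀ {k} e (i : Fin (suc k)) → e ≤ suc k →
  toℕ (cycPred^ e i) + e ≡ toℕ i ⊎ toℕ (cycPred^ e i) + e ≡ toℕ i + suc k
toℕ-cycPred^ zero i _ = inj₁ (ℕ.+-identityʳ _)
toℕ-cycPred^ {k} (suc e) i e<k with cycPred^ e i | toℕ-cycPred^ e i (ℕ.<⇒≤ e<k)
... | suc x | ih rewrite Fin.toℕ-inject₁ x | ℕ.+-suc (toℕ x) e = ih
... | zero  | inj₁ e≡i rewrite Fin.toℕ-fromℕ k | e≡i = inj₂ (trans (ℕ.+-comm k _) (sym (ℕ.+-suc _ k)))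
... | zero  | inj₂ e≡i+k = contradiction (ℕ.≤-<-trans (ℕ.m≤n+m _ (toℕ i)) (subst (_< suc k) e≡i+k e<k)) (ℕ.n≮n _)

cycPred^-≢ : ∀ {k} e (i : Fin (suc k)) → 0 < e → e < suc k → cycPred^ e i ≢ i
cycPred^-≢ e i 0<e e<k eq with toℕ-cycPred^ e i (ℕ.<⇒≤ e<k)
... | inj₁ p rewrite eq = ℕ.<⇒≢ 0<e (sym (ℕ.+-cancelˡ-≡ (toℕ i) _ _ (trans p (sym (ℕ.+-identityʳ _)))))
... | inj₂ p rewrite eq = ℕ.<⇒≢ e<k (ℕ.+-cancelˡ-≡ (toℕ i) _ _ p)

cycPred^-period : ∀ {k} (i : Fin (suc k)) → cycPred^ (suc k) i ≡ i
cycPred^-period {k} i with toℕ-cycPred^ (suc k) i ℕ.≤-refl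
... | inj₁ p = contradiction (ℕ.≤-<-trans (ℕ.≤-trans (ℕ.m≤n+m _ _) (ℕ.≤-reflexive p)) (Fin.toℕ<n i)) (ℕ.n≮n _)
... | inj₂ p = Fin.toℕ-injective (ℕ.+-cancelʳ-≡ (suc k) _ _ p)

-- An adjacency would return to `i` after `2 + d` predecessor steps or to `cycPred i` after `d`,
-- both positive and shorter than the cycle.
cycPred^-nonadjacent : ∀ {k} d (i : Fin (suc k)) → 0 < d → 2 + d < suc k → ¬ CycAdj (suc k) i (cycPred^ (suc d) i)
cycPred^-nonadjacent d i 0<d 2+d<k (inj₁ succ) =
  cycPred^-≢ (2 + d) i (s≤s z≤n) 2+d<k (sym (cycPred-unique succ))
cycPred^-nonadjacent d i 0<d 2+d<k (inj₂ succ) =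
  cycPred^-≢ d (cycPred i) 0<d (ℕ.<-trans (ℕ.<-trans (ℕ.n<1+n d) (ℕ.n<1+n _)) 2+d<k)
    (trans (sym (fold-+ i cycPred d)) (trans (cong (fold i cycPred) (ℕ.+-comm d 1)) (cycPred-unique succ)))

CycSucc? : ∀ k i j → Dec (CycSucc k i j)
CycSucc? k i j = toℕ j ℕ.≟ suc (toℕ i) ⊎-dec (suc (toℕ i) ℕ.≟ k ×-dec toℕ j ℕ.≟ 0)

CycAdj? : ∀ k i j → Dec (CycAdj k i j)
CycAdj? k i j = CycSucc? k i j ⊎-dec CycSucc? k j i

-- By exhaustion: `a`, `d`, `c`, `b` is the way round the square that avoids the edge `ab`.
square-completion : ∀ a b → CycAdj 4 a b →
  ∃[ d ] ∃[ c ] (CycAdj 4 a d × CycAdj 4 d c × CycAdj 4 c b × d ≢ b × c ≢ a)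
square-completion = toWitness {a? = Fin.all? λ a → Fin.all? λ b → CycAdj? 4 a b →-dec
  Fin.any? λ d → Fin.any? λ c →
    CycAdj? 4 a d ×-dec CycAdj? 4 d c ×-dec CycAdj? 4 c b ×-dec ¬? (d Fin.≟ b) ×-dec ¬? (c Fin.≟ a)} tt

-- Flaps on holes of the induced subgraph.

module _ (G : Graph) (triangle-free : TriangleFree G) (sunspot-free : SunspotFree4 G)
  {m} (ι : Fin m → V G) (ι-injective : Injective _≡_ _≡_ ι)
  (liberal : Liberal (induced G m ι))
  (parent : ∀ i → ∃[ p ] ∃[ q ] (E G (ι i) p × E G p q × ∀ j → ¬ E G q (ι j)))
  where

  private
    L = induced G m ι

    InL : V G → Set
    InL v = ∃[ i ] ι i ≡ v

    private-neighbour : ∀ {x y} → InL x → InL y → x ≢ y → ¬ E G x y →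
                        ∃[ z ] (InL z × E G x z × ¬ E G y z)
    private-neighbour (i , refl) (j , refl) x≢y x≁y with liberal i j (x≢y ∘ cong ι) x≁y
    ... | (z , x~z , y≁z) , _ = ι z , (z , refl) , x~z , y≁z

    anchored-parent : ∀ {x} → InL x →
      ∃[ p ] (E G x p × Anchored G triangle-free sunspot-free InL private-neighbour p)
    anchored-parent (i , refl) with parent i
    ... | p , q , i~p , p~q , q≁L = p , i~p , q , p~q , λ { (j , refl) → q≁L j }

  no-flap-edge : ∀ {k} (h : Fin (6 + k) → V L) → Hole L (6 + k) h → ∀ f → Hole L 4 f →
    ∀ {i j a b} → CycSucc (6 + k) j i → CycAdj 4 a b → h i ≡ f a → h j ≡ f b → ⊥
  no-flap-edge {k} h (_ , _ , h-adjacent) f (_ , f-injective , f-adjacent) {i} {j} {a} {b} j→i a~b hi≡fa hj≡fb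
    with square-completion a b a~b
  ... | d , c , a~d , d~c , c~b , d≢b , c≢a =
    no-flap G triangle-free sunspot-free InL private-neighbour anchored-parent w
      (λ t → _ , refl)
      (λ t → proj₂ (h-adjacent _ _) (inj₂ (cycPred-succ (at t))))
      (λ t → gap t 1 (s≤s z≤n) (s≤s (s≤s (s≤s (s≤s z≤n)))))
      (λ t → gap t 2 (s≤s z≤n) (s≤s (s≤s (s≤s (s≤s (s≤s z≤n))))))
      -- The bound `5 < 6 + k` is tight: here length at least 6 is used in full.
      (λ t → gap t 3 (s≤s z≤n) (s≤s (s≤s (s≤s (s≤s (s≤s (s≤s z≤n)))))))
      (f d , refl) (f c , refl)
      (subst (λ x → E L x (f d)) (sym h4≡fa) (proj₂ (f-adjacent a d) a~d))
      (proj₂ (f-adjacent d c) d~c)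
      (subst (E L (f c)) (sym h5≡fb) (proj₂ (f-adjacent c b) c~b))
      (λ eq → d≢b (f-injective (trans (ι-injective eq) h5≡fb)))
      (λ eq → c≢a (f-injective (trans (ι-injective eq) h4≡fa)))
    where
    -- Starting 4 steps before i, the walk has the edge ij at positions 4 and 5.
    at : ℕ → Fin (6 + k)
    at = fold (cycPred^ (2 + k) i) cycPred

    w : ℕ → V G
    w = ι ∘ h ∘ at

    h4≡fa : h (at 4) ≡ f a
    h4≡fa = trans (cong h (cycPred^-period i)) hi≡fa

    h5≡fb : h (at 5) ≡ f b
    h5≡fb = trans (cong h (trans (cong cycPred (cycPred^-period i)) (sym (cycPred-unique j→i)))) hj≡fb

    gap : ∀ t d → 0 < d → 2 + d < 6 + k → ¬ E G (w t) (ι (h (cycPred^ (suc d) (at t))))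
    gap t d 0<d 2+d<k = cycPred^-nonadjacent d (at t) 0<d 2+d<k ∘ proj₁ (h-adjacent _ _)

  -- The walk follows predecessors, so an edge given in the other direction has its ends exchanged
  -- first.
  flapless : Flapless L
  flapless _ h h-hole (s≤s (s≤s (s≤s (s≤s (s≤s (s≤s z≤n)))))) f
    (f-hole , i , j , a , b , inj₁ i→j , a~b , hi≡fa , hj≡fb) =
    no-flap-edge h h-hole f f-hole i→j (swap a~b) hj≡fb hi≡fa
  flapless _ h h-hole (s≤s (s≤s (s≤s (s≤s (s≤s (s≤s z≤n)))))) f
    (f-hole , i , j , a , b , inj₂ j→i , a~b , hi≡fa , hj≡fb) =
    no-flap-edge h h-hole f f-hole j→i a~b hi≡fa hj≡fb

-- Colourability and critical subgraphs.

Colorable? : ∀ G k → Dec (Colorable G k)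
Colorable? G k = map′
  (λ (x , proper) → finToFun x , proper)
  -- `finToFun` inverts `funToFin` only pointwise, so properness is transported pair by pair.
  (λ (f , proper) → funToFin f , λ u v u~v → proper u v u~v ∘ finToFun-≡ f u v)
  (Fin.any? λ x → Fin.all? λ u → Fin.all? λ v →
    E? G u v →-dec ¬? (finToFun x u Fin.≟ finToFun x v))
  where
  finToFun-≡ : ∀ (f : V G → Fin k) u v → finToFun (funToFin f) u ≡ finToFun (funToFin f) v → f u ≡ f v
  finToFun-≡ f u v eq = trans (sym (Fin.finToFun-funToFin f u)) (trans eq (Fin.finToFun-funToFin f v))

Colorable-mono : ∀ G {j k} → j ≤ k → Colorable G j → Colorable G k
Colorable-mono G j≤k (f , proper) =
  (λ v → inject≤ (f v) j≤k) , λ u v u~v → proper u v u~v ∘ Fin.inject≤-injective j≤k j≤k _ _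

punchIn-or-≡ : ∀ {k} (v u : Fin (suc k)) → u ≡ v ⊎ ∃[ i ] u ≡ punchIn v i
punchIn-or-≡ v u with v Fin.≟ u
... | yes v≡u = inj₁ (sym v≡u)
... | no  v≢u = inj₂ (punchOut v≢u , sym (Fin.punchIn-punchOut v≢u))

-- The common step of the chromatic number, degree and private neighbour arguments: a deleted vertex
-- returns with a colour absent from its neighbours.
extend-coloring : ∀ (G : Graph) {k} (ι : Fin (suc k) → V G) v {c} →
  ((f , _) : Colorable (induced G k (ι ∘ punchIn v)) c) (x : Fin c) →
  (∀ i → E G (ι v) (ι (punchIn v i)) → f i ≢ x) → Colorable (induced G (suc k) ι) c
extend-coloring G {k} ι v {c} (f , f-proper) x x-free = F , F-proper
  where
  F : Fin (suc k) → Fin c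
  F = insertAt f v x

  F-proper : ∀ u u′ → E G (ι u) (ι u′) → F u ≢ F u′
  F-proper u u′ u~u′ eq with punchIn-or-≡ v u | punchIn-or-≡ v u′
  ... | inj₁ refl       | inj₁ refl       = contradiction (trans (sym u~u′) (Graph.irrefl G _)) λ ()
  ... | inj₁ refl       | inj₂ (j , refl) = x-free j u~u′
    (trans (sym (insertAt-punchIn f v x j)) (trans (sym eq) (insertAt-lookup f v x)))
  ... | inj₂ (i , refl) | inj₁ refl       = x-free i (E-sym G u~u′)
    (trans (sym (insertAt-punchIn f v x i)) (trans eq (insertAt-lookup f v x)))
  ... | inj₂ (i , refl) | inj₂ (j , refl) = f-proper i j u~u′
    (trans (sym (insertAt-punchIn f v x i)) (trans eq (insertAt-punchIn f v x j)))

-- Pigeonhole: if all colours occurred, their positions would inject `Fin c` into a smaller set.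
missing-element : ∀ {c} (xs : List (Fin c)) → length xs < c → ∃[ x ] ¬ x ∈ xs
missing-element {c} xs short = Fin.¬∀⟶∃¬ c (_∈ xs) (λ x → _∈?_ Fin._≟_ x xs) λ every →
  Fin.<⇒notInjective short λ {x} {y} eq →
    trans (lookup-index (every x)) (trans (cong (List.lookup xs) eq) (sym (lookup-index (every y))))

-- Vertex-criticality. The vertex type `Fin (suc k)` lets `punchIn v` express deletion of `v`.
CriticalSubgraph : Graph → ℕ → Set
CriticalSubgraph G c = ∃[ k ] Σ (Fin (suc k) → V G) λ κ → Injective _≡_ _≡_ κ
  × ¬ Colorable (induced G (suc k) κ) c
  × (∀ v → Colorable (induced G k (κ ∘ punchIn v)) c)

-- Vertices are deleted while the rest stays uncolourable; this stops because the empty graph is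
-- always colourable.
critical-subgraph : ∀ G c → ¬ Colorable G c → CriticalSubgraph G c
critical-subgraph G c = shrink (n G) id id
  where
  shrink : ∀ m (ι : Fin m → V G) → Injective _≡_ _≡_ ι → ¬ Colorable (induced G m ι) c → CriticalSubgraph G c
  shrink zero    ι ι-injective uncolorable = contradiction ((λ ()) , λ ()) uncolorable
  shrink (suc m) ι ι-injective uncolorable
    with Fin.all? (λ v → Colorable? (induced G m (ι ∘ punchIn v)) c)
  ... | yes colorable = m , ι , ι-injective , uncolorable , colorable
  ... | no ¬colorable with Fin.¬∀⟶∃¬ _ _ (λ v → Colorable? (induced G m (ι ∘ punchIn v)) c) ¬colorable
  ...   | v , uncolorable′ = shrink m (ι ∘ punchIn v) (Fin.punchIn-injective v _ _ ∘ ι-injective) uncolorable′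

module _ (G : Graph) {k} (ι : Fin (suc k) → V G) {c}
  (uncolorable : ¬ Colorable (induced G (suc k) ι) c)
  (deletion : ∀ v → Colorable (induced G k (ι ∘ punchIn v)) c) where

  private
    L = induced G (suc k) ι

  critical-chromatic : ChromaticNumber L (suc c)
  critical-chromatic =
    extend-coloring G ι zero
      (inject₁ ∘ proj₁ (deletion zero) , λ u v u~v → proj₂ (deletion zero) u v u~v ∘ Fin.inject₁-injective)
      -- The deleted vertex gets the one colour beyond the first `c`.
      (fromℕ c) (λ i _ → Fin.fromℕ≢inject₁ ∘ sym) ,
    λ { j (s≤s j≤c) → uncolorable ∘ Colorable-mono L j≤c }

  critical-nonDegenerate : NonDegenerate L
  critical-nonDegenerate χ (_ , minimal) v =
    -- The `suc c`-colouring gives `χ ≤ suc c`, so it suffices that the degree is at least `c`.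
    ℕ.≤-trans (ℕ.∸-monoˡ-≤ 1 (ℕ.≮⇒≥ λ c<χ → minimal (suc c) c<χ (proj₁ critical-chromatic)))
              (ℕ.≮⇒≥ refute)
    where
    neighbours = filterᵇ (adj L v) (allFin (suc k))

    refute : ¬ degree L v < c
    refute short =
      let
        -- The colour given to v itself is irrelevant.
        colour = insertAt (proj₁ (deletion v)) v (fromℕ< short)
        (x , x∉) = missing-element (map colour neighbours)
                     (subst (_< c) (sym (List.length-map colour neighbours)) short)
      in uncolorable (extend-coloring G ι v (deletion v) x λ i v~i fi≡x → x∉
           (subst (_∈ map colour neighbours) (trans (insertAt-punchIn (proj₁ (deletion v)) v _ i) fi≡x)
             (∈-map⁺ colour (∈-filter⁺ (T? ∘ adj L v) (∈-allFin (punchIn v i)) (subst T (sym v~i) tt)))))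

  -- Otherwise `y` sees every neighbour of `x`, so in a colouring of the rest the colour of `y` is
  -- free for `x`.
  critical-private-neighbour : ∀ x y → x ≢ y → ¬ E L x y → ∃[ z ] (E L x z × ¬ E L y z)
  critical-private-neighbour x y x≢y x≁y = decidable-stable
    (Fin.any? λ z → E? L x z ×-dec ¬? (E? L y z)) λ dominated →
    uncolorable (extend-coloring G ι x (deletion x) (proj₁ (deletion x) (punchOut x≢y)) λ i x~i →
      proj₂ (deletion x) i (punchOut x≢y)
        (E-sym G (decidable-stable (E? G _ _) λ y≁i → dominated
          (_ , x~i , λ y~i → y≁i (subst (λ u → E L u (punchIn x i)) (sym (Fin.punchIn-punchOut x≢y)) y~i)))))

  critical-liberal : Liberal L
  critical-liberal x y x≢y x≁y =
    critical-private-neighbour x y x≢y x≁y ,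
    critical-private-neighbour y x (x≢y ∘ sym) (x≁y ∘ E-sym L)

-- Colourings of vertex sets.

ColorableOn : (G : Graph) → Pred (V G) 0ℓ → ℕ → Set
ColorableOn G P k = Σ (V G → Fin k) λ f → ∀ {u v} → P u → P v → E G u v → f u ≢ f v

stable-colorable : ∀ G {P k} → (∀ {u v} → P u → P v → ¬ E G u v) → ColorableOn G P (suc k)
stable-colorable G stable = (λ _ → zero) , λ u∈P v∈P u~v → contradiction u~v (stable u∈P v∈P)

∪-colorable : ∀ G {P Q j k} → Decidable P → ColorableOn G P j → ColorableOn G Q k → ColorableOn G (P ∪ Q) (j + k)
∪-colorable G {P} {Q} {j} {k} P? (f , f-proper) (g , g-proper) = h , h-proper
  where
  h : V G → Fin (j + k)
  h v with P? v
  ... | yes _ = f v ↑ˡ k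
  ... | no  _ = j ↑ʳ g v

  ↑ˡ≢↑ʳ : ∀ (x : Fin j) (y : Fin k) → x ↑ˡ k ≢ j ↑ʳ y
  ↑ˡ≢↑ʳ x y eq with trans (sym (Fin.splitAt-↑ˡ j x k)) (trans (cong (splitAt j) eq) (Fin.splitAt-↑ʳ j k y))
  ... | ()

  h-proper : ∀ {u v} → (P ∪ Q) u → (P ∪ Q) v → E G u v → h u ≢ h v
  h-proper {u} {v} u∈ v∈ u~v with P? u | P? v
  ... | yes u∈P | yes v∈P = f-proper u∈P v∈P u~v ∘ Fin.↑ˡ-injective k _ _
  ... | yes _   | no  _   = ↑ˡ≢↑ʳ _ _
  ... | no  _   | yes _   = ↑ˡ≢↑ʳ _ _ ∘ sym
  ... | no  u∉P | no  v∉P = g-proper (fromInj₂ (⊥-elim ∘ u∉P) u∈) (fromInj₂ (⊥-elim ∘ v∉P) v∈) u~v ∘ Fin.↑ʳ-injective j _ _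

-- With no edges between them, `P` and `Q` can share one palette, so the colours do not add up.
anticomplete-∪-colorable : ∀ G {P Q k} → Decidable P → (∀ {u v} → P u → Q v → ¬ E G u v) →
  ColorableOn G P k → ColorableOn G Q k → ColorableOn G (P ∪ Q) k
anticomplete-∪-colorable G {P} {Q} {k} P? anticomplete (f , f-proper) (g , g-proper) = h , h-proper
  where
  h : V G → Fin k
  h v with P? v
  ... | yes _ = f v
  ... | no  _ = g v

  h-proper : ∀ {u v} → (P ∪ Q) u → (P ∪ Q) v → E G u v → h u ≢ h v
  h-proper {u} {v} u∈ v∈ u~v with P? u | P? v
  ... | yes u∈P | yes v∈P = f-proper u∈P v∈P u~v
  ... | yes u∈P | no  v∉P = contradiction u~v (anticomplete u∈P (fromInj₂ (⊥-elim ∘ v∉P) v∈))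
  ... | no  u∉P | yes v∈P = contradiction (E-sym G u~v) (anticomplete v∈P (fromInj₂ (⊥-elim ∘ u∉P) u∈))
  ... | no  u∉P | no  v∉P = g-proper (fromInj₂ (⊥-elim ∘ u∉P) u∈) (fromInj₂ (⊥-elim ∘ v∉P) v∈) u~v

unique-lookup-injective : ∀ {A : Set} {xs : List A} → Unique xs → Injective _≡_ _≡_ (List.lookup xs)
unique-lookup-injective (x∉ ∷ u) {zero}  {zero}  eq = refl
unique-lookup-injective (x∉ ∷ u) {zero}  {suc j} eq = contradiction eq (All.lookup x∉ (∈-lookup j))
unique-lookup-injective (x∉ ∷ u) {suc i} {zero}  eq = contradiction (sym eq) (All.lookup x∉ (∈-lookup i))
unique-lookup-injective (x∉ ∷ u) {suc i} {suc j} eq = cong suc (unique-lookup-injective u eq)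

-- Turns a decidable vertex set into an injection, the form in which induced subgraphs are given.
enumerate : ∀ {n} {P : Pred (Fin n) 0ℓ} → Decidable P →
  ∃[ m ] Σ (Fin m → Fin n) λ ι → Injective _≡_ _≡_ ι × (∀ i → P (ι i)) × (∀ {v} → P v → ∃[ i ] v ≡ ι i)
enumerate {n} P? = length members , List.lookup members ,
  unique-lookup-injective (Unique.filter⁺ P? (Unique.allFin⁺ n)) ,
  (λ i → proj₂ (∈-filter⁻ P? {xs = allFin n} (∈-lookup {xs = members} i))) ,
  (λ v∈P → let v∈ = ∈-filter⁺ P? (∈-allFin _) v∈P in index v∈ , lookup-index v∈)
  where
  members = filter P? (allFin n)

induced-colorableOn : ∀ G {P m k} {ι : Fin m → V G} → Decidable P → (∀ {v} → P v → ∃[ i ] v ≡ ι i) →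
  Colorable (induced G m ι) (suc k) → ColorableOn G P (suc k)
induced-colorableOn G {P} {k = k} {ι} P? onto (f , f-proper) = h , h-proper
  where
  h : V G → Fin (suc k)
  h v with P? v
  ... | yes v∈P = f (proj₁ (onto v∈P))
  -- A default colour outside `P`; it requires the palette to be nonempty.
  ... | no  _   = zero

  h-proper : ∀ {u v} → P u → P v → E G u v → h u ≢ h v
  h-proper {u} {v} u∈P v∈P u~v with P? u | P? v
  ... | yes u∈P | yes v∈P = f-proper _ _ (subst₂ (E G) (proj₂ (onto u∈P)) (proj₂ (onto v∈P)) u~v)
  ... | no  u∉P | _       = contradiction u∈P u∉P
  ... | yes _   | no  v∉P = contradiction v∈P v∉P

-- Distance layers around scattered roots.

module _ (G : Graph) where

  Ball : List (V G) → ℕ → Pred (V G) 0ℓ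
  Ball R zero    v = v ∈ R
  Ball R (suc j) v = Ball R j v ⊎ ∃[ u ] (E G v u × Ball R j u)

  Ball? : ∀ R j → Decidable (Ball R j)
  Ball? R zero    v = _∈?_ Fin._≟_ v R
  Ball? R (suc j) v = Ball? R j v ⊎-dec Fin.any? λ u → E? G v u ×-dec Ball? R j u

  Ball-mono : ∀ {R R′} → (∀ {v} → v ∈ R → v ∈ R′) → ∀ j {v} → Ball R j v → Ball R′ j v
  Ball-mono R⊆R′ zero    v∈                     = R⊆R′ v∈
  Ball-mono R⊆R′ (suc j) (inj₁ v∈)              = inj₁ (Ball-mono R⊆R′ j v∈)
  Ball-mono R⊆R′ (suc j) (inj₂ (u , v~u , u∈))  = inj₂ (u , v~u , Ball-mono R⊆R′ j u∈)

  -- An edge rs is also the walk r s r s, so this excludes edges inside R as well.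
  Scattered : List (V G) → Set
  Scattered R = ∀ {r s u v} → r ∈ R → s ∈ R → r ≢ s → E G r u → E G u v → E G v s → ⊥

  -- A vertex becomes a root only if it is not within distance 3 of the roots chosen so far, which
  -- rules out a walk of length 3 to any of them.
  scattered-covering : ∀ vs → ∃[ R ] (Scattered R × ∀ {v} → v ∈ vs → Ball R 3 v)
  scattered-covering [] = [] , (λ ()) , λ ()
  scattered-covering (v ∷ vs) with scattered-covering vs
  ... | R , scattered , covers with Ball? R 3 v
  ...   | yes v∈ = R , scattered , λ { (here refl) → v∈ ; (there u∈) → covers u∈ }
  ...   | no  v∉ = v ∷ R , scattered′ ,
      λ { (here refl) → inj₁ (inj₁ (inj₁ (here refl))) ; (there u∈) → Ball-mono there 3 (covers u∈) }
    where
    far : ∀ {s u u′} → s ∈ R → E G v u → E G u u′ → E G u′ s → ⊥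
    far s∈R v~u u~u′ u′~s = v∉ (inj₂ (_ , v~u , inj₂ (_ , u~u′ , inj₂ (_ , u′~s , s∈R))))

    scattered′ : Scattered (v ∷ R)
    scattered′ (here refl) (here refl) r≢s = contradiction refl r≢s
    scattered′ (here refl) (there s∈R) _   = far s∈R
    scattered′ (there r∈R) (here refl) _   r~u u~v v~s = far r∈R (E-sym G v~s) (E-sym G u~v) (E-sym G r~u)
    scattered′ (there r∈R) (there s∈R) r≢s = scattered r∈R s∈R r≢s

  -- The index is shifted: these are the vertices at distance exactly `j + 1` from `R`.
  Layer : List (V G) → ℕ → Pred (V G) 0ℓ
  Layer R j v = Ball R (suc j) v × ¬ Ball R j v

  Layer? : ∀ R j → Decidable (Layer R j)
  Layer? R j v = Ball? R (suc j) v ×-dec ¬? (Ball? R j v)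

  layer-parent : ∀ {R j v} → Layer R j v → ∃[ p ] (E G v p × Ball R j p)
  layer-parent (inj₁ v∈ , v∉) = contradiction v∈ v∉
  layer-parent (inj₂ v∈ , v∉) = v∈

  -- `q` lies within distance `j` of `R`, so its neighbours are too close to the roots to be in the
  -- layer.
  layer-grandparent : ∀ {R j v} → Layer R (suc j) v →
    ∃[ p ] ∃[ q ] (E G v p × E G p q × ∀ {u} → Layer R (suc j) u → ¬ E G q u)
  layer-grandparent v∈@(_ , v∉) with layer-parent v∈
  ... | p , v~p , inj₁ p∈ = contradiction (inj₂ (p , v~p , p∈)) v∉
  ... | p , v~p , inj₂ (q , p~q , q∈) =
    p , q , v~p , p~q , λ (_ , u∉) q~u → u∉ (inj₂ (q , E-sym G q~u , q∈))

  module _ (triangle-free : TriangleFree G) {R} (scattered : Scattered R)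
    (covers : ∀ v → Ball R 3 v) where

    roots-stable : ∀ {r s} → r ∈ R → s ∈ R → ¬ E G r s
    roots-stable {r} {s} r∈ s∈ r~s with r Fin.≟ s
    ... | yes refl = contradiction (trans (sym r~s) (Graph.irrefl G r)) λ ()
    ... | no  r≢s  = scattered r∈ s∈ r≢s r~s (E-sym G r~s) r~s

    -- The ends of an edge have either a common root, giving a triangle, or two roots joined by a
    -- walk of length 3.
    first-layer-stable : ∀ {u v} → Layer R 0 u → Layer R 0 v → ¬ E G u v
    first-layer-stable u∈ v∈ u~v with layer-parent u∈ | layer-parent v∈
    ... | r , u~r , r∈ | s , v~s , s∈ with r Fin.≟ s
    ...   | yes refl = triangle-free _ _ _ u~v v~s u~r
    ...   | no  r≢s  = scattered r∈ s∈ r≢s (E-sym G u~r) u~v v~s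

    -- One colour serves distance 1 and one palette distance 2. The roots share the other palette
    -- with distance 3, as no edge joins those two sets.
    layers-colorable : ∀ {c} → ColorableOn G (Layer R 1) (suc c) → ColorableOn G (Layer R 2) (suc c) →
                       Colorable G (1 + (suc c + suc c))
    layers-colorable col₂ col₃ =
      let (f , f-proper) = ∪-colorable G (Layer? R 0) (stable-colorable G {k = 0} first-layer-stable)
            (∪-colorable G (Layer? R 1) col₂
              (anticomplete-∪-colorable G (Ball? R 0)
                (λ {u} {v} r∈ (_ , v∉) r~v → v∉ (inj₁ (inj₂ (u , E-sym G r~v , r∈))))
                (stable-colorable G roots-stable) col₃))
      in f , λ u v → f-proper (classify u) (classify v)
      where
      classify : ∀ v → (Layer R 0 ∪ (Layer R 1 ∪ (Ball R 0 ∪ Layer R 2))) v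
      classify v with Ball? R 0 v | Ball? R 1 v | Ball? R 2 v
      ... | yes v∈₀ | _       | _       = inj₂ (inj₂ (inj₁ v∈₀))
      ... | no  v∉₀ | yes v∈₁ | _       = inj₁ (v∈₁ , v∉₀)
      ... | no  _   | no  v∉₁ | yes v∈₂ = inj₂ (inj₁ (v∈₂ , v∉₁))
      ... | no  _   | no  _   | no  v∉₂ = inj₂ (inj₂ (inj₂ (covers v , v∉₂)))

-- The critical subgraph inside one layer.

LiberalFlaplessSubgraph : Graph → ℕ → Set
LiberalFlaplessSubgraph G χ = ∃[ m ] Σ (Fin m → V G) λ ι → Injective _≡_ _≡_ ι
  × ChromaticNumber (induced G m ι) χ
  × NonDegenerate (induced G m ι)
  × Liberal (induced G m ι)
  × Flapless (induced G m ι)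

-- The index `suc j` means distance at least 2 from the roots, so the grandparents wanted by
-- `flapless` exist.
layer-subgraph : ∀ G → TriangleFree G → SunspotFree4 G → ∀ {c R j m} (ι : Fin m → V G) →
  Injective _≡_ _≡_ ι → (∀ i → Layer G R (suc j) (ι i)) → ¬ Colorable (induced G m ι) c →
  LiberalFlaplessSubgraph G (suc c)
layer-subgraph G triangle-free sunspot-free {c} ι ι-injective ι∈ uncolorable
  with critical-subgraph (induced G _ ι) c uncolorable
... | k , κ , κ-injective , κ-uncolorable , deletion =
  suc k , ι ∘ κ , κ-injective ∘ ι-injective ,
  critical-chromatic G (ι ∘ κ) κ-uncolorable deletion ,
  critical-nonDegenerate G (ι ∘ κ) κ-uncolorable deletion ,
  liberal ,
  flapless G triangle-free sunspot-free (ι ∘ κ) (κ-injective ∘ ι-injective) liberal λ i →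
    let (p , q , i~p , p~q , q≁) = layer-grandparent G (ι∈ (κ i))
    in p , q , i~p , p~q , λ j → q≁ (ι∈ (κ j))
  where
  liberal = critical-liberal G (ι ∘ κ) κ-uncolorable deletion

theorem2p1 : (c : ℕ) → 1 ≤ c → (G : Graph) → TriangleFree G → SunspotFree4 G
    → ChromaticNumberGreaterThan G (2 * c + 1)
    → ∃[ m ] Σ (Fin m → V G) λ ι → Injective _≡_ _≡_ ι
    × ChromaticNumber (induced G m ι) (suc c)
    × NonDegenerate (induced G m ι)
    × Liberal (induced G m ι)
    × Flapless (induced G m ι)
-- Exposing `suc` supplies the default colour for `induced-colorableOn` and a colour for the roots.
theorem2p1 c@(suc _) _ G triangle-free sunspot-free χ>2c+1 with scattered-covering G (allFin (n G))
... | R , scattered , covers with enumerate (Layer? G R 1) | enumerate (Layer? G R 2)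
...   | m₂ , ι₂ , ι₂-injective , ι₂∈ , ι₂-onto | m₃ , ι₃ , ι₃-injective , ι₃∈ , ι₃-onto
  with Colorable? (induced G m₂ ι₂) c | Colorable? (induced G m₃ ι₃) c
... | no uncolorable | _              = layer-subgraph G triangle-free sunspot-free ι₂ ι₂-injective ι₂∈ uncolorable
... | yes _          | no uncolorable = layer-subgraph G triangle-free sunspot-free ι₃ ι₃-injective ι₃∈ uncolorable
... | yes col₂       | yes col₃       = contradiction (χ>2c+1 _ colorable) (ℕ.n≮n _)
  where
  1+c+c≡2c+1 : 1 + (c + c) ≡ 2 * c + 1
  1+c+c≡2c+1 = trans (cong (λ x → suc (c + x)) (sym (ℕ.+-identityʳ c))) (ℕ.+-comm 1 (2 * c))

  colorable : Colorable G (2 * c + 1)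
  colorable = subst (Colorable G) 1+c+c≡2c+1
    (layers-colorable G triangle-free scattered (λ v → covers (∈-allFin v))
      (induced-colorableOn G (Layer? G R 1) ι₂-onto col₂)
      (induced-colorableOn G (Layer? G R 2) ι₃-onto col₃))
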